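{- Let $X=X_1\cup X_2$ be a finite set of elements of a metric space with metric $d$, partitioned into two disjoint groups $X_1,X_2$, let $k_1,k_2\in\mathbb{Z}^+$ with $|X_i|\ge k_i$ for $i\in\{1,2\}$, $k=k_1+k_2$, $\varepsilon\in(0,1)$, and $\Delta=d_{max}/d_{min}$. Algorithm SFDM1 (defined in the context), run on $X$ presented as a stream, stores $O\big(\frac{k\log\Delta}{\varepsilon}\big)$ elements in memory, takes $O\big(\frac{k\log\Delta}{\varepsilon}\big)$ time per element for stream processing, and spends $O\big(\frac{k^2\log\Delta}{\varepsilon}\big)$ time for post-processing.
   Context: Time is measured by the number of distance computations, each costing $O(1)$. For $S\subseteq X$, $div(S)=\min_{x,y\in S,\,x\ne y}d(x,y)$, and for $x\in X$, $d(x,S)=\min_{y\in S}d(x,y)$; a minimum over the empty set is $+\infty$. Here $d_{min}=\min_{x\neq y\in X}d(x,y)$ and $d_{max}=\max_{x,y\in X}d(x,y)$. Algorithm SFDM1. Stream processing: Let $\mathcal{U}=\{\frac{d_{min}}{(1-\varepsilon)^j}: j\in\mathbb{Z}_{\ge0},\ \frac{d_{min}}{(1-\varepsilon)^j}\in[d_{min},d_{max}]\}$. Initialize $S_\mu=S_{\mu,1}=S_{\mu,2}=\emptyset$ for each $\mu\in\mathcal{U}$. For each arriving $x\in X$ (one pass) and each $\mu\in\mathcal{U}$: if $|S_\mu|<k$ and $d(x,S_\mu)\ge\mu$, add $x$ to $S_\mu$; and, for the group $i$ with $x\in X_i$, if $|S_{\mu,i}|<k_i$ and $d(x,S_{\mu,i})\ge\mu$,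 add $x$ to $S_{\mu,i}$. Post-processing: Let $\mathcal{U}'=\{\mu\in\mathcal{U}: |S_\mu|=k \text{ and } |S_{\mu,i}|=k_i \text{ for } i\in\{1,2\}\}$ (evaluated at the end of the stream). For each $\mu\in\mathcal{U}'$, if $|S_\mu\cap X_i|<k_i$ for some $i\in\{1,2\}$, then: (a) while $|S_\mu\cap X_i|<k_i$, let $x^+\in\arg\max_{x\in S_{\mu,i}}d(x,S_\mu\cap X_i)$ and add $x^+$ to $S_\mu$; (b) then, while $|S_\mu|>k$, let $x^-\in\arg\min_{x\in S_\mu\setminus X_i}d(x,S_\mu\cap X_i)$ and remove $x^-$ from $S_\mu$. Return the post-processed $S_\mu$, $\mu\in\mathcal{U}'$, with maximum $div(S_\mu)$. -}

module Defs where

open import Level using (Level; _⊔_) renaming (suc to lsuc)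
open import Algebra.Bundles using (CommutativeRing; Semiring)
open import Data.Bool using (if_then_else_)
open import Data.Fin using (Fin; zero; suc; _≟_)
open import Data.Fin.Properties using (any?; all?)
open import Data.List using (List; []; _∷_; length; filter; map; lookup; allFin)
open import Data.List.Relation.Unary.All using () renaming (all? to allList?)
open import Data.Nat using (ℕ; zero; suc; _<?_; _∸_) renaming (_+_ to _+ₙ_; _≤_ to _≤ₙ_; _<_ to _<ₙ_; _≟_ to _≟ₙ_; _⊔_ to _⊔ₙ_)
open import Data.Product using (∃-syntax; _×_; _,_; proj₁; proj₂)
open import Data.Unit using (⊤; tt)
open import Data.Vec using (Vec; replicate; _[_]≔_) renaming (lookup to _‼_)
import Data.Vec as Vec
import Data.Vec.Membership.Setoid as VecMembership
import Data.Vec.Relation.Unary.Unique.Setoid as VecUnique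
open import Function.Base using (case_of_)
open import Function.Bundles using (_⇔_)
open import Function.Metric.Structures using (IsGeneralMetric)
open import Relation.Binary.Bundles using (TotalOrder)
open import Relation.Binary.Core using (Rel)
open import Relation.Binary.PropositionalEquality using (_≡_; _≢_)
open import Relation.Binary.Structures using (IsDecTotalOrder)
open import Relation.Nullary using (Dec; yes; no; does; ¬_)
open import Relation.Nullary.Construct.Add.Supremum using (_⁺; [_]; ⊤⁺)
open import Relation.Nullary.Decidable using (¬?; _×-dec_)
import Algebra.Construct.NaturalChoice.Min as Min
import Algebra.Definitions.RawSemiring as RawSemiringDefs
import Relation.Binary.Construct.Add.Supremum.NonStrict as AddSupremum
import Relation.Binary.Construct.NonStrictToStrict as ToStrict

-- The properties of ℝ that are used: an Archimedean ordered field with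
-- decidable order, together with a logarithm.  The classical real numbers are
-- an instance, with  log  the logarithm to any base greater than 1 (over ℝ the
-- laws below determine  log  up to the choice of base).  The value of  _⁻¹  at
-- zero and of  log  at non-positive arguments is irrelevant.
record RealField (c ℓ₁ ℓ₂ : Level) : Set (lsuc (c ⊔ ℓ₁ ⊔ ℓ₂)) where
  field
    commutativeRing : CommutativeRing c ℓ₁

  open CommutativeRing commutativeRing public
  open RawSemiringDefs (Semiring.rawSemiring semiring) public using (_^_) renaming (_×_ to _·_)

  infix 4 _≤_
  infix 8 _⁻¹

  field
    _≤_             : Rel Carrier ℓ₂
    isDecTotalOrder : IsDecTotalOrder _≈_ _≤_

  open IsDecTotalOrder isDecTotalOrder public using (_≤?_; isTotalOrder)
  open ToStrict _≈_ _≤_ public using (_<_)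

  field
    +-monoʳ-≤   : ∀ x {y z} → y ≤ z → (x + y) ≤ (x + z)
    *-nonNeg    : ∀ {x y} → 0# ≤ x → 0# ≤ y → 0# ≤ (x * y)
    0≉1         : ¬ (0# ≈ 1#)
    _⁻¹         : Carrier → Carrier
    ⁻¹-cong     : ∀ {x y} → x ≈ y → (x ⁻¹) ≈ (y ⁻¹)
    ⁻¹-inverse  : ∀ {x} → ¬ (x ≈ 0#) → (x * x ⁻¹) ≈ 1#
    archimedean : ∀ x → ∃[ n ] x ≤ (n · 1#)
    log         : Carrier → Carrier
    log-cong    : ∀ {x y} → x ≈ y → log x ≈ log y
    log-*       : ∀ {x y} → 0# < x → 0# < y → log (x * y) ≈ (log x + log y)
    log-mono-<  : ∀ {x y} → 0# < x → x < y → log x < log y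

  fromℕ : ℕ → Carrier
  fromℕ n = n · 1#

  -- Distances with +∞ adjoined, for minima over the empty set.
  Carrier∞ : Set c
  Carrier∞ = Carrier ⁺

  open AddSupremum _≤_ public using (_≤⁺_; ≤⁺-dec)

  _≤∞?_ : ∀ x y → Dec (x ≤⁺ y)
  _≤∞?_ = ≤⁺-dec _≤?_

  totalOrder∞ : TotalOrder c (c ⊔ ℓ₁) (c ⊔ ℓ₂)
  totalOrder∞ = record { isTotalOrder = AddSupremum.≤⁺-isTotalOrder _≤_ isTotalOrder }

  open Min totalOrder∞ public using (_⊓_)

record MetricSpace {c ℓ₁ ℓ₂} (R : RealField c ℓ₁ ℓ₂) (a ℓ : Level) : Set (c ⊔ ℓ₁ ⊔ ℓ₂ ⊔ lsuc (a ⊔ ℓ)) where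
  private module R = RealField R
  infix 4 _≈_
  field
    Point    : Set a
    _≈_      : Rel Point ℓ
    d        : Point → Point → R.Carrier
    isMetric : IsGeneralMetric _≈_ R._≈_ R._≤_ R.0# R._+_ d

Group : Set
Group = Fin 2

-- SFDM1 for a ground set of N elements, numbered in order of arrival, and n
-- thresholds U.  The metric is not a parameter: an algorithm can learn
-- distances only through the operation  dist  of the language  Prog.
module Algorithm
  {c ℓ₁ ℓ₂} (R : RealField c ℓ₁ ℓ₂)
  {N : ℕ} (group : Fin N → Group) (ks : Group → ℕ)
  {n : ℕ} (U : Vec (RealField.Carrier R) n)
  where

  open RealField R using (Carrier; Carrier∞; _≤∞?_; _⊓_)

  k : ℕ
  k = ks zero +ₙ ks (suc zero)

  Elem : Set
  Elem = Fin N

  -- The candidates S_μ and S_{μ,i} belonging to one threshold μ.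
  record Slot : Set where
    constructor slot
    field
      all : List Elem
      own : Vec (List Elem) 2

  open Slot public

  Memory : Set
  Memory = Vec Slot n

  empty : Memory
  empty = replicate n (slot [] (replicate 2 []))

  slotSize : Slot → ℕ
  slotSize s = length (all s) +ₙ Vec.sum (Vec.map length (own s))

  size : Memory → ℕ
  size m = Vec.sum (Vec.map slotSize m)

  -- Programs that compute distances, make arbitrary choices (used to break
  -- ties), and read and overwrite the memory.
  data Prog {a} (A : Set a) : Set (a ⊔ c) where
    return : A → Prog A
    dist   : Elem → Elem → (Carrier → Prog A) → Prog A
    choose : (m : ℕ) → (Fin m → Prog A) → Prog A
    get    : (Memory → Prog A) → Prog A
    put    : Memory → Prog A → Prog A

  infixl 1 _>>=_ _>>_

  _>>=_ : ∀ {a b} {A : Set a} {B : Set b} → Prog A → (A → Prog B) → Prog B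
  return x   >>= g = g x
  dist x y f >>= g = dist x y (λ r → f r >>= g)
  choose m f >>= g = choose m (λ i → f i >>= g)
  get f      >>= g = get (λ m → f m >>= g)
  put m p    >>= g = put m (p >>= g)

  _>>_ : ∀ {a b} {A : Set a} {B : Set b} → Prog A → Prog B → Prog B
  p >> q = p >>= λ _ → q

  mapM : ∀ {a b} {A : Set a} {B : Set b} → (A → Prog B) → List A → Prog (List B)
  mapM f []       = return []
  mapM f (x ∷ xs) = do
    y  ← f x
    ys ← mapM f xs
    return (y ∷ ys)

  forM_ : ∀ {a} {A : Set a} → List A → (A → Prog ⊤) → Prog ⊤
  forM_ []       f = return tt
  forM_ (x ∷ xs) f = f x >> forM_ xs f

  pick : ∀ {a} {A : Set a} → List A → Prog A
  pick xs = choose (length xs) λ i → return (lookup xs i)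

  read : Fin n → Prog Slot
  read j = get λ m → return (m ‼ j)

  write : Fin n → Slot → Prog ⊤
  write j s = get λ m → put (m [ j ]≔ s) (return tt)

  argmax argmin : ∀ {a} {A : Set a} → List (A × Carrier∞) → List A
  argmax ps = map proj₁ (filter (λ p → allList? (λ q → proj₂ q ≤∞? proj₂ p) ps) ps)
  argmin ps = map proj₁ (filter (λ p → allList? (λ q → proj₂ p ≤∞? proj₂ q) ps) ps)

  distTo : Elem → List Elem → Prog Carrier∞
  distTo x []       = return ⊤⁺
  distTo x (y ∷ ys) = dist x y λ r → do
    s ← distTo x ys
    return ([ r ] ⊓ s)

  diversity : List Elem → Prog Carrier∞
  diversity []       = return ⊤⁺
  diversity (x ∷ xs) = do
    r ← distTo x xs
    s ← diversity xs
    return (r ⊓ s)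

  infix 6 _∩_ _∖_

  _∩_ _∖_ : List Elem → Group → List Elem
  S ∩ i = filter (λ x → group x ≟ i) S
  S ∖ i = filter (λ x → ¬? (group x ≟ i)) S

  tryAdd : ℕ → Carrier → Elem → List Elem → Prog (List Elem)
  tryAdd cap μ x S with length S <? cap
  ... | no  _ = return S
  ... | yes _ = do
    r ← distTo x S
    return (if does ([ μ ] ≤∞? r) then x ∷ S else S)

  observe : Elem → Prog ⊤
  observe x = forM_ (allFin n) λ j → do
    let i = group x
    s  ← read j
    S  ← tryAdd k      (U ‼ j) x (all s)
    Sᵢ ← tryAdd (ks i) (U ‼ j) x (own s ‼ i)
    write j (slot S (own s [ i ]≔ Sᵢ))

  stream : List Elem → Prog ⊤
  stream xs = forM_ xs observe

  insert : Fin n → Elem → Prog ⊤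
  insert j x = do
    s ← read j
    write j (record s { all = x ∷ all s })

  remove : Fin n → Elem → Prog ⊤
  remove j x = do
    s ← read j
    write j (record s { all = filter (λ y → ¬? (y ≟ x)) (all s) })

  -- In the two loops below, every element carries its current distance to
  -- S_μ ∩ X_i.  In the first loop this set grows by x⁺ alone, so updating a
  -- distance takes one evaluation of the metric; in the second it is constant.
  -- The loop "while |S_μ ∩ X_i| < k_i" adds one element of X_i per round and
  -- "while |S_μ| > k" removes one element of S_μ per round, so each runs
  -- exactly as many rounds as the initial difference of the two sides.

  grow : Fin n → ℕ → List (Elem × Carrier∞) → Prog ⊤
  grow j zero    pool = return tt
  grow j (suc r) pool = do
    x⁺    ← pick (argmax pool)
    insert j x⁺
    pool′ ← mapM (λ (x , δ) → dist x x⁺ λ δ′ → return (x , δ ⊓ [ δ′ ])) pool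
    grow j r pool′

  shrink : Fin n → ℕ → List (Elem × Carrier∞) → Prog ⊤
  shrink j zero    pool = return tt
  shrink j (suc r) pool = do
    x⁻ ← pick (argmin pool)
    remove j x⁻
    shrink j r (filter (λ (x , _) → ¬? (x ≟ x⁻)) pool)

  withDistTo : List Elem → Elem → Prog (Elem × Carrier∞)
  withDistTo T x = do
    δ ← distTo x T
    return (x , δ)

  balance : Fin n → Group → Prog ⊤
  balance j i = do
    s     ← read j
    pool  ← mapM (withDistTo (all s ∩ i)) (own s ‼ i)
    grow j (ks i ∸ length (all s ∩ i)) pool
    s′    ← read j
    pool′ ← mapM (withDistTo (all s′ ∩ i)) (all s′ ∖ i)
    shrink j (length (all s′) ∸ k) pool′

  repair : Fin n → Prog ⊤
  repair j = do
    s ← read j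
    case any? (λ i → length (all s ∩ i) <? ks i) of λ where
      (yes (i , _)) → balance j i
      (no _)        → return tt

  full? : (s : Slot) → Dec (length (all s) ≡ k × (∀ i → length (own s ‼ i) ≡ ks i))
  full? s = (length (all s) ≟ₙ k) ×-dec all? (λ i → length (own s ‼ i) ≟ₙ ks i)

  postprocess : Prog (List Elem)
  postprocess = do
    m  ← get return
    let U′ = filter (λ j → full? (m ‼ j)) (allFin n)
    forM_ U′ repair
    ds ← mapM (λ j → read j >>= λ s → diversity (all s) >>= λ v → return (all s , v)) U′
    pick (argmax ds)

  sfdm1 : Prog (List Elem)
  sfdm1 = stream (allFin N) >> postprocess

  -- Run d p m x m′ t s : with distances given by d and initial memory m, the
  -- program p can return x with final memory m′, computing t distances and
  -- with s the largest number of stored elements at any time.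
  data Run (d : Elem → Elem → Carrier) {a} {A : Set a} :
           Prog A → Memory → A → Memory → ℕ → ℕ → Set (a ⊔ c) where
    return : ∀ {x m} → Run d (return x) m x m 0 (size m)
    dist   : ∀ {x y f m z m′ t s} → Run d (f (d x y)) m z m′ t s →
             Run d (dist x y f) m z m′ (suc t) s
    choose : ∀ {l f m z m′ t s} (i : Fin l) → Run d (f i) m z m′ t s →
             Run d (choose l f) m z m′ t s
    get    : ∀ {f m z m′ t s} → Run d (f m) m z m′ t s →
             Run d (get f) m z m′ t s
    put    : ∀ {m₁ p m z m′ t s} → Run d p m₁ z m′ t s →
             Run d (put m₁ p) m z m′ t (size m ⊔ₙ s)

-- X = {x₀, …, x_{N-1}}, numbered in order of arrival.
record Input {c ℓ₁ ℓ₂} (R : RealField c ℓ₁ ℓ₂) (a ℓ : Level) : Set (c ⊔ ℓ₁ ⊔ ℓ₂ ⊔ lsuc (a ⊔ ℓ)) where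
  open RealField R

  field
    space    : MetricSpace R a ℓ

  private module M = MetricSpace space

  field
    N        : ℕ
    point    : Fin N → M.Point
    distinct : ∀ {x y} → point x M.≈ point y → x ≡ y
    group    : Fin N → Group

  d : Fin N → Fin N → Carrier
  d x y = M.d (point x) (point y)

  field
    ks       : Group → ℕ
    ks>0     : ∀ i → 0 <ₙ ks i
    enough   : ∀ i → ks i ≤ₙ length (filter (λ x → group x ≟ i) (allFin N))

    ε        : Carrier
    ε>0      : 0# < ε
    ε<1      : ε < 1#

    dmin dmax     : Carrier
    dmin-attained : ∃[ x ] ∃[ y ] (x ≢ y × dmin ≈ d x y)
    dmin-least    : ∀ {x y} → x ≢ y → dmin ≤ d x y
    dmax-attained : ∃[ x ] ∃[ y ] dmax ≈ d x y
    dmax-greatest : ∀ {x y} → d x y ≤ dmax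

    -- U lists the set of thresholds without repetition, in any order.
    n        : ℕ
    U        : Vec Carrier n
    U-unique : VecUnique.Unique setoid U
    U-spec   : ∀ μ → VecMembership._∈_ setoid μ U ⇔
                 ((∃[ j ] μ ≈ (dmin * ((1# - ε) ^ j) ⁻¹)) × dmin ≤ μ × μ ≤ dmax)

  Δ : Carrier
  Δ = dmax * dmin ⁻¹

  open Algorithm R group ks U public

-- Each threshold dmin / (1 - ε)ʲ is at most dmax, so j log (1/(1 - ε)) ≤ log Δ;
-- since log (1/(1 - ε)) ≥ ε (log 2)/2 and 1 ≤ log Δ / log Δ₀, there are
-- O(log Δ / ε) thresholds.  For one threshold at most 3k elements are ever
-- stored, an arriving element costs at most 2k distances (k per candidate), and
-- the repair and the diversity of its candidate cost at most 10k².

module Submission where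

open import Defs
open import Data.Nat using () renaming (_^_ to _^ₙ_)
open import Data.List using (_∷_; _++_; allFin)
open import Data.Product using (∃-syntax; _×_)
open import Relation.Binary.PropositionalEquality using (_≡_)

open import Data.Bool using (true; false; if_then_else_)
open import Data.Fin using (Fin; zero; suc; fromℕ<)
import Data.Fin.Properties as Fin
open import Data.List using (List; []; length; filter)
open import Data.List.Properties using (length-filter; length-tabulate)
open import Data.List.Relation.Unary.All using (All; []; _∷_)
import Data.List.Relation.Unary.All as All
open import Data.List.Relation.Unary.AllPairs using (_∷_)
open import Data.List.Relation.Unary.Unique.Propositional using (Unique)
import Data.List.Relation.Unary.Unique.Propositional.Properties as Unique
open import Data.Nat using (ℕ; zero; suc; z≤n; s≤s)
  renaming (_*_ to _*ₙ_; _≤_ to _≤ₙ_; _<_ to _<ₙ_)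
import Data.Nat
import Data.Nat.Properties as ℕ
open import Data.Nat.Solver using (module +-*-Solver)
open import Data.Product using (_,_; proj₁; proj₂)
open import Data.Sum using (inj₁; inj₂)
open import Data.Unit using (⊤; tt)
open import Data.Vec using (Vec; []; _∷_; _[_]≔_) renaming (lookup to _‼_)
import Data.Vec as Vec
open import Data.Vec.Membership.Propositional.Properties using (∈-lookup)
open import Data.Vec.Properties using (lookup∘update; lookup∘update′; lookup-replicate)
import Data.Vec.Relation.Unary.Any as VecAny
import Data.Vec.Relation.Unary.Unique.Setoid.Properties as VecUnique
open import Function.Base using (_∘_)
open import Function.Bundles using (module Equivalence)
open import Function.Metric.Structures using (module IsGeneralMetric)
import Level
open import Relation.Binary.Bundles using (TotalOrder)
open import Relation.Binary.PropositionalEquality using (_≢_)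
import Relation.Binary.PropositionalEquality as ≡
open import Relation.Binary.Structures using (module IsDecTotalOrder)
open import Relation.Nullary using (¬_; Dec; yes; no; does; contradiction)
open import Relation.Nullary.Construct.Add.Supremum using ([_])
open import Relation.Nullary.Decidable using (¬?)
import Algebra.Properties.Ring as RingProperties
import Algebra.Properties.Semiring.Mult as SemiringMult
import Algebra.Solver.Ring.NaturalCoefficients.Default as SemiringSolver
import Relation.Binary.Reasoning.PartialOrder as PartialOrderReasoning

-- `U` always contains `dmin`, with exponent 0, so something is stored however close Δ is to 1,
-- whereas log Δ tends to 0 there. The constant therefore has to depend on a fixed `Δ₀` above 1 that
-- bounds Δ from below. The cost half argues about list lengths alone: ties are broken arbitrarily,
-- and no triple records that an inserted element is new or that a removal shortens S_μ. A grown S_μ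
-- is thus charged at length 2k from then on, which accounts for 8 of the 10 in the constant. Memory
-- use is a maximum over all moments of a run, so its bound is carried by the same triples as the
-- time bound.

module FieldProperties {c ℓ₁ ℓ₂} (R : RealField c ℓ₁ ℓ₂) where
  open RealField R
  open IsDecTotalOrder isDecTotalOrder using (_≟_)
  open RingProperties ring using (-1*x≈-x; -‿involutive)
  open SemiringSolver commutativeSemiring using (solve; _:=_; _:+_; _:*_)

  -- Ordered-field arithmetic and the embedding of the naturals.

  totalOrder : TotalOrder c ℓ₁ ℓ₂
  totalOrder = record { isTotalOrder = isTotalOrder }

  open TotalOrder totalOrder using (poset; total; antisym)
    renaming (refl to ≤-refl; reflexive to ≤-reflexive; trans to ≤-trans)
  open PartialOrderReasoning poset

  +-monoˡ-≤ : ∀ {x y} z → x ≤ y → (x + z) ≤ (y + z)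
  +-monoˡ-≤ {x} {y} z x≤y = begin
    x + z ≈⟨ +-comm x z ⟩
    z + x ≤⟨ +-monoʳ-≤ z x≤y ⟩
    z + y ≈⟨ +-comm z y ⟩
    y + z ∎

  +-mono-≤ : ∀ {x y u v} → x ≤ y → u ≤ v → (x + u) ≤ (y + v)
  +-mono-≤ x≤y u≤v = ≤-trans (+-monoˡ-≤ _ x≤y) (+-monoʳ-≤ _ u≤v)

  x≤y⇒0≤y-x : ∀ {x y} → x ≤ y → 0# ≤ (y - x)
  x≤y⇒0≤y-x {x} {y} x≤y = begin
    0#    ≈⟨ -‿inverseʳ x ⟨
    x - x ≤⟨ +-monoˡ-≤ (- x) x≤y ⟩
    y - x ∎

  x-y+y≈x : ∀ x y → ((x - y) + y) ≈ x
  x-y+y≈x x y = begin-equality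
    (x - y) + y     ≈⟨ +-assoc x (- y) y ⟩
    x + (- y + y)   ≈⟨ +-congˡ (-‿inverseˡ y) ⟩
    x + 0#          ≈⟨ +-identityʳ x ⟩
    x               ∎

  +-cancelʳ-≤ : ∀ {x y} z → (x + z) ≤ (y + z) → x ≤ y
  +-cancelʳ-≤ {x} {y} z x+z≤y+z = begin
    x             ≈⟨ shift x ⟨
    (x + z) - z   ≤⟨ +-monoˡ-≤ (- z) x+z≤y+z ⟩
    (y + z) - z   ≈⟨ shift y ⟩
    y             ∎
    where
    shift : ∀ w → ((w + z) - z) ≈ w
    shift w = begin-equality
      (w + z) - z   ≈⟨ +-assoc w z (- z) ⟩
      w + (z - z)   ≈⟨ +-congˡ (-‿inverseʳ z) ⟩
      w + 0#        ≈⟨ +-identityʳ w ⟩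
      w             ∎

  *-monoˡ-≤ : ∀ {x y z} → 0# ≤ z → x ≤ y → (x * z) ≤ (y * z)
  *-monoˡ-≤ {x} {y} {z} 0≤z x≤y = begin
    x * z                 ≈⟨ +-identityˡ (x * z) ⟨
    0# + x * z            ≤⟨ +-monoˡ-≤ (x * z) (*-nonNeg (x≤y⇒0≤y-x x≤y) 0≤z) ⟩
    (y - x) * z + x * z   ≈⟨ distribʳ z (y - x) x ⟨
    ((y - x) + x) * z     ≈⟨ *-congʳ (x-y+y≈x y x) ⟩
    y * z                 ∎

  *-monoʳ-≤ : ∀ {x y z} → 0# ≤ z → x ≤ y → (z * x) ≤ (z * y)
  *-monoʳ-≤ {x} {y} {z} 0≤z x≤y = begin
    z * x ≈⟨ *-comm z x ⟩
    x * z ≤⟨ *-monoˡ-≤ 0≤z x≤y ⟩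
    y * z ≈⟨ *-comm y z ⟩
    z * y ∎

  -- If 1 were at most 0, then -1 would be nonnegative, and its square is 1.
  0≤1 : 0# ≤ 1#
  0≤1 with total 0# 1#
  ... | inj₁ 0≤1 = 0≤1
  ... | inj₂ 1≤0 = begin
    0#            ≤⟨ *-nonNeg 0≤-1 0≤-1 ⟩
    - 1# * - 1#   ≈⟨ -1*x≈-x (- 1#) ⟩
    - (- 1#)      ≈⟨ -‿involutive 1# ⟩
    1#            ∎
    where
    0≤-1 : 0# ≤ (- 1#)
    0≤-1 = ≤-trans (x≤y⇒0≤y-x 1≤0) (≤-reflexive (+-identityˡ (- 1#)))

  0<1 : 0# < 1#
  0<1 = 0≤1 , 0≉1

  <⇒≱ : ∀ {x y} → x < y → ¬ (y ≤ x)
  <⇒≱ (x≤y , x≉y) y≤x = x≉y (antisym x≤y y≤x)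

  <-≤-trans : ∀ {x y z} → x < y → y ≤ z → x < z
  <-≤-trans (x≤y , x≉y) y≤z =
    ≤-trans x≤y y≤z , λ x≈z → x≉y (antisym x≤y (≤-trans y≤z (≤-reflexive (sym x≈z))))

  <-resp-≈ : ∀ {x y x′ y′} → x ≈ x′ → y ≈ y′ → x < y → x′ < y′
  <-resp-≈ x≈x′ y≈y′ (x≤y , x≉y) =
    ≤-trans (≤-reflexive (sym x≈x′)) (≤-trans x≤y (≤-reflexive y≈y′)) ,
    λ x′≈y′ → x≉y (trans x≈x′ (trans x′≈y′ (sym y≈y′)))

  >⇒≉0 : ∀ {x} → 0# < x → ¬ (x ≈ 0#)
  >⇒≉0 (_ , 0≉x) x≈0 = 0≉x (sym x≈0)

  x*y*y⁻¹≈x : ∀ {x y} → 0# < y → (x * y * y ⁻¹) ≈ x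
  x*y*y⁻¹≈x {x} {y} 0<y = begin-equality
    x * y * y ⁻¹    ≈⟨ *-assoc x y (y ⁻¹) ⟩
    x * (y * y ⁻¹)  ≈⟨ *-congˡ (⁻¹-inverse (>⇒≉0 0<y)) ⟩
    x * 1#          ≈⟨ *-identityʳ x ⟩
    x               ∎

  *-pos : ∀ {x y} → 0# < x → 0# < y → 0# < (x * y)
  *-pos {x} {y} (0≤x , 0≉x) 0<y@(0≤y , _) = *-nonNeg 0≤x 0≤y , λ 0≈xy → 0≉x (begin-equality
    0#             ≈⟨ zeroˡ (y ⁻¹) ⟨
    0# * y ⁻¹      ≈⟨ *-congʳ 0≈xy ⟩
    x * y * y ⁻¹   ≈⟨ x*y*y⁻¹≈x 0<y ⟩
    x              ∎)

  ⁻¹-pos : ∀ {x} → 0# < x → 0# < (x ⁻¹)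
  ⁻¹-pos {x} 0<x@(0≤x , _) = 0≤x⁻¹ , λ 0≈x⁻¹ → 0≉1 (begin-equality
    0#         ≈⟨ zeroʳ x ⟨
    x * 0#     ≈⟨ *-congˡ 0≈x⁻¹ ⟩
    x * x ⁻¹   ≈⟨ ⁻¹-inverse (>⇒≉0 0<x) ⟩
    1#         ∎)
    where
    0≤x⁻¹ : 0# ≤ (x ⁻¹)
    0≤x⁻¹ with total 0# (x ⁻¹)
    ... | inj₁ 0≤x⁻¹ = 0≤x⁻¹
    ... | inj₂ x⁻¹≤0 = contradiction 1≤0 (<⇒≱ 0<1)
      where
      1≤0 : 1# ≤ 0#
      1≤0 = begin
        1#         ≈⟨ ⁻¹-inverse (>⇒≉0 0<x) ⟨
        x * x ⁻¹   ≤⟨ *-monoʳ-≤ 0≤x x⁻¹≤0 ⟩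
        x * 0#     ≈⟨ zeroʳ x ⟩
        0#         ∎

  *⇒≤-*⁻¹ : ∀ {x y z} → 0# < z → (x * z) ≤ y → x ≤ (y * z ⁻¹)
  *⇒≤-*⁻¹ {x} {y} {z} 0<z xz≤y = begin
    x              ≈⟨ x*y*y⁻¹≈x 0<z ⟨
    x * z * z ⁻¹   ≤⟨ *-monoˡ-≤ (proj₁ (⁻¹-pos 0<z)) xz≤y ⟩
    y * z ⁻¹       ∎

  1≤x⁻¹ : ∀ {x} → 0# < x → x ≤ 1# → 1# ≤ (x ⁻¹)
  1≤x⁻¹ {x} 0<x x≤1 = begin
    1#          ≤⟨ *⇒≤-*⁻¹ 0<x (≤-trans (≤-reflexive (*-identityˡ x)) x≤1) ⟩
    1# * x ⁻¹   ≈⟨ *-identityˡ (x ⁻¹) ⟩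
    x ⁻¹        ∎

  ^-pos : ∀ {x} j → 0# < x → 0# < (x ^ j)
  ^-pos zero    0<x = 0<1
  ^-pos (suc j) 0<x = *-pos 0<x (^-pos j 0<x)

  fromℕ-nonNeg : ∀ m → 0# ≤ fromℕ m
  fromℕ-nonNeg zero    = ≤-refl
  fromℕ-nonNeg (suc m) = begin
    0#            ≈⟨ +-identityˡ 0# ⟨
    0# + 0#       ≤⟨ +-mono-≤ 0≤1 (fromℕ-nonNeg m) ⟩
    1# + fromℕ m  ∎

  fromℕ-mono-≤ : ∀ {m n} → m ≤ₙ n → fromℕ m ≤ fromℕ n
  fromℕ-mono-≤ {n = n} z≤n = fromℕ-nonNeg n
  fromℕ-mono-≤ {suc m} {suc n} (s≤s m≤n) = +-monoʳ-≤ 1# (fromℕ-mono-≤ {m} {n} m≤n)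

  -- Otherwise `suc n` is at most `m`, and monotonicity would give 1 + n ≤ n in the field. This
  -- turns real bounds on exponents back into bounds in ℕ.
  fromℕ-cancel-≤ : ∀ {m n} → fromℕ m ≤ fromℕ n → m ≤ₙ n
  fromℕ-cancel-≤ {m} {n} m≤n with m ℕ.≤? n
  ... | yes p = p
  ... | no ¬p = contradiction 1≤0 (<⇒≱ 0<1)
    where
    1≤0 : 1# ≤ 0#
    1≤0 = +-cancelʳ-≤ (fromℕ n) (begin
      fromℕ (suc n)   ≤⟨ fromℕ-mono-≤ {suc n} {m} (ℕ.≰⇒> ¬p) ⟩
      fromℕ m         ≤⟨ m≤n ⟩
      fromℕ n         ≈⟨ +-identityˡ (fromℕ n) ⟨
      0# + fromℕ n    ∎)

  -- The witness of `archimedean` may be far too large, so the search descends from it until the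
  -- predecessor falls to `x` or below; that predecessor yields the upper estimate.
  ceiling : ∀ {x} → 0# ≤ x → ∃[ m ] (x ≤ fromℕ m × fromℕ m ≤ (1# + x))
  ceiling {x} 0≤x = search (proj₁ (archimedean x)) (proj₂ (archimedean x))
    where
    search : ∀ m → x ≤ fromℕ m → ∃[ m ] (x ≤ fromℕ m × fromℕ m ≤ (1# + x))
    search zero    x≤0   = 0 , x≤0 , (begin
      0#       ≈⟨ +-identityˡ 0# ⟨
      0# + 0#  ≤⟨ +-mono-≤ 0≤1 0≤x ⟩
      1# + x   ∎)
    search (suc m) x≤1+m with total x (fromℕ m)
    ... | inj₁ x≤m = search m x≤m
    ... | inj₂ m≤x = suc m , x≤1+m , +-monoʳ-≤ 1# m≤x

  bernoulli : ∀ {x} m → 0# ≤ x → (1# + fromℕ m * x) ≤ ((1# + x) ^ m)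
  bernoulli {x} zero    0≤x = ≤-reflexive (trans (+-congˡ (zeroˡ x)) (+-identityʳ 1#))
  bernoulli {x} (suc m) 0≤x = begin
    1# + (1# + M) * x              ≈⟨ +-congˡ (trans (distribʳ x 1# M) (+-congʳ (*-identityˡ x))) ⟩
    1# + (x + M * x)               ≈⟨ +-identityʳ _ ⟨
    -- The nonnegative product x * (M * x) is added so that the sum factors as (1 + x) * (1 + M *
    -- x).
    (1# + (x + M * x)) + 0#        ≤⟨ +-monoʳ-≤ _ (*-nonNeg 0≤x (*-nonNeg (fromℕ-nonNeg m) 0≤x)) ⟩
    (1# + (x + M * x)) + x * (M * x) ≈⟨ solve 3 (λ i x y →
      ((i :+ (x :+ y)) :+ x :* y) := ((i :+ y) :+ (x :+ x :* y))) refl 1# x (M * x) ⟩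
    (1# + M * x) + (x + x * (M * x)) ≈⟨ +-cong (*-identityˡ _)
      (trans (distribˡ x 1# _) (+-congʳ (*-identityʳ x))) ⟨
    1# * (1# + M * x) + x * (1# + M * x) ≈⟨ distribʳ _ 1# x ⟨
    (1# + x) * (1# + M * x)        ≤⟨ *-monoʳ-≤ 0≤1+x (bernoulli m 0≤x) ⟩
    (1# + x) * (1# + x) ^ m        ∎
    where
    M : Carrier
    M = fromℕ m

    0≤1+x : 0# ≤ (1# + x)
    0≤1+x = ≤-trans (≤-reflexive (sym (+-identityˡ 0#))) (+-mono-≤ 0≤1 0≤x)

  -- The logarithm and powers of 1 - ε.

  log-mono-≤ : ∀ {x y} → 0# < x → x ≤ y → log x ≤ log y
  log-mono-≤ {x} {y} 0<x x≤y with x ≟ y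
  ... | yes x≈y = ≤-reflexive (log-cong x≈y)
  ... | no  x≉y = proj₁ (log-mono-< 0<x (x≤y , x≉y))

  -- Additivity at 1 * 1 gives log 1 = log 1 + log 1; one copy is then cancelled.
  log1≈0 : log 1# ≈ 0#
  log1≈0 = begin-equality
    log 1#                       ≈⟨ +-identityʳ _ ⟨
    log 1# + 0#                  ≈⟨ +-congˡ (-‿inverseʳ (log 1#)) ⟨
    log 1# + (log 1# - log 1#)   ≈⟨ +-assoc _ _ _ ⟨
    (log 1# + log 1#) - log 1#   ≈⟨ +-congʳ (log-* 0<1 0<1) ⟨
    log (1# * 1#) - log 1#       ≈⟨ +-congʳ (log-cong (*-identityˡ 1#)) ⟩
    log 1# - log 1#              ≈⟨ -‿inverseʳ (log 1#) ⟩
    0#                           ∎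

  log-pos : ∀ {x} → 1# < x → 0# < log x
  log-pos 1<x = <-resp-≈ log1≈0 refl (log-mono-< 0<1 1<x)

  log-^ : ∀ {x} j → 0# < x → log (x ^ j) ≈ (fromℕ j * log x)
  log-^ {x} zero    0<x = trans log1≈0 (sym (zeroˡ (log x)))
  log-^ {x} (suc j) 0<x = begin-equality
    log (x * x ^ j)             ≈⟨ log-* 0<x (^-pos j 0<x) ⟩
    log x + log (x ^ j)         ≈⟨ +-cong (sym (*-identityˡ (log x))) (log-^ j 0<x) ⟩
    1# * log x + fromℕ j * log x ≈⟨ distribʳ (log x) 1# (fromℕ j) ⟨
    fromℕ (suc j) * log x       ∎

  2# : Carrier
  2# = 1# + 1#

  1<2 : 1# < 2#
  1<2 = ≤-trans (≤-reflexive (sym (+-identityˡ 1#))) (+-monoˡ-≤ 1# 0≤1) , λ 1≈2 →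
    <⇒≱ 0<1 (+-cancelʳ-≤ 1# (≤-reflexive (trans (sym 1≈2) (sym (+-identityˡ 1#)))))

  0<2 : 0# < 2#
  0<2 = <-≤-trans 0<1 (proj₁ 1<2)

  -- Thresholds per unit of log Δ / ε: 2 / log 2 comes from the bound on the exponents, and 2 / log
  -- Δ₀ pays for two more thresholds, one for exponent 0 and one for rounding up.
  rate : Carrier → Carrier
  rate Δ₀ = 2# * (log Δ₀ ⁻¹ + log 2# ⁻¹)

  module _ {ε} (0<ε : 0# < ε) (ε<1 : ε < 1#) where

    0<1-ε : 0# < (1# - ε)
    0<1-ε = x≤y⇒0≤y-x (proj₁ ε<1) , λ 0≈1-ε → proj₂ ε<1 (begin-equality
      ε             ≈⟨ +-identityˡ ε ⟨
      0# + ε        ≈⟨ +-congʳ 0≈1-ε ⟩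
      (1# - ε) + ε  ≈⟨ x-y+y≈x 1# ε ⟩
      1#            ∎)

    -- For m = ⌈1/ε⌉ ≤ 2/ε Bernoulli's inequality gives (1 + ε)ᵐ ≥ 2, and
    -- (1 + ε)(1 - ε) ≤ 1; hence log 2 ≤ m log (1 + ε) ≤ - m log (1 - ε).
    log2≤ : log 2# ≤ (2# * ε ⁻¹ * - log (1# - ε))
    log2≤ with ceiling (proj₁ (⁻¹-pos 0<ε))
    ... | m , ε⁻¹≤m , m≤1+ε⁻¹ = begin
      log 2#                       ≤⟨ log-mono-≤ 0<2
        (≤-trans (+-monoʳ-≤ 1# 1≤mε) (bernoulli m (proj₁ 0<ε))) ⟩
      log ((1# + ε) ^ m)           ≈⟨ log-^ m 0<1+ε ⟩
      fromℕ m * log (1# + ε)       ≤⟨ *-monoʳ-≤ (fromℕ-nonNeg m) log[1+ε]≤x ⟩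
      fromℕ m * x                  ≤⟨ *-monoˡ-≤ 0≤x m≤2ε⁻¹ ⟩
      2# * ε ⁻¹ * x                ∎
      where
      q x : Carrier
      q = 1# - ε
      x = - log q

      1≤1+ε : 1# ≤ (1# + ε)
      1≤1+ε = ≤-trans (≤-reflexive (sym (+-identityʳ 1#))) (+-monoʳ-≤ 1# (proj₁ 0<ε))

      0<1+ε : 0# < (1# + ε)
      0<1+ε = <-≤-trans 0<1 1≤1+ε

      1≤mε : 1# ≤ (fromℕ m * ε)
      1≤mε = begin
        1#           ≈⟨ ⁻¹-inverse (>⇒≉0 0<ε) ⟨
        ε * ε ⁻¹     ≈⟨ *-comm ε (ε ⁻¹) ⟩
        ε ⁻¹ * ε     ≤⟨ *-monoˡ-≤ (proj₁ 0<ε) ε⁻¹≤m ⟩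
        fromℕ m * ε  ∎

      m≤2ε⁻¹ : fromℕ m ≤ (2# * ε ⁻¹)
      m≤2ε⁻¹ = begin
        fromℕ m                  ≤⟨ m≤1+ε⁻¹ ⟩
        1# + ε ⁻¹                ≤⟨ +-monoˡ-≤ (ε ⁻¹) (1≤x⁻¹ 0<ε (proj₁ ε<1)) ⟩
        ε ⁻¹ + ε ⁻¹              ≈⟨ +-cong (*-identityˡ _) (*-identityˡ _) ⟨
        1# * ε ⁻¹ + 1# * ε ⁻¹    ≈⟨ distribʳ (ε ⁻¹) 1# 1# ⟨
        2# * ε ⁻¹                ∎

      q≤1 : q ≤ 1#
      q≤1 = +-cancelʳ-≤ ε (≤-trans (≤-reflexive (x-y+y≈x 1# ε)) 1≤1+ε)

      [1+ε]q≤1 : ((1# + ε) * q) ≤ 1#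
      [1+ε]q≤1 = begin
        (1# + ε) * q     ≈⟨ trans (distribʳ q 1# ε) (+-congʳ (*-identityˡ q)) ⟩
        q + ε * q        ≤⟨ +-monoʳ-≤ q (*-monoʳ-≤ (proj₁ 0<ε) q≤1) ⟩
        q + ε * 1#       ≈⟨ +-congˡ (*-identityʳ ε) ⟩
        q + ε            ≈⟨ x-y+y≈x 1# ε ⟩
        1#               ∎

      log[1+ε]≤x : log (1# + ε) ≤ x
      log[1+ε]≤x = +-cancelʳ-≤ (log q) (begin
        log (1# + ε) + log q    ≈⟨ log-* 0<1+ε 0<1-ε ⟨
        log ((1# + ε) * q)      ≤⟨ log-mono-≤ (*-pos 0<1+ε 0<1-ε) [1+ε]q≤1 ⟩
        log 1#                  ≈⟨ log1≈0 ⟩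
        0#                      ≈⟨ -‿inverseˡ (log q) ⟨
        x + log q               ∎)

      0≤x : 0# ≤ x
      0≤x = ≤-trans (≤-trans (≤-reflexive (sym log1≈0)) (log-mono-≤ 0<1 1≤1+ε)) log[1+ε]≤x

    -- Taking logarithms gives j * (- log (1 - ε)) ≤ log x; `log2≤` bounds - log (1 - ε) from below,
    -- and division by log 2 isolates j.
    exponent-bound : ∀ {x} j → 0# < x → ((1# - ε) ^ j) ⁻¹ ≤ x →
                     fromℕ j ≤ (2# * log 2# ⁻¹ * (log x * ε ⁻¹))
    exponent-bound {x} j 0<x q⁻ʲ≤x = begin
      fromℕ j                                 ≤⟨ *⇒≤-*⁻¹ (log-pos 1<2) j*log2≤ ⟩
      2# * ε ⁻¹ * log x * log 2# ⁻¹           ≈⟨ solve 4 (λ t e l i →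
        (t :* e :* l :* i) := (t :* i :* (l :* e))) refl 2# (ε ⁻¹) (log x) (log 2# ⁻¹) ⟩
      2# * log 2# ⁻¹ * (log x * ε ⁻¹)         ∎
      where
      q J : Carrier
      q = 1# - ε
      J = fromℕ j

      0<qʲ : 0# < (q ^ j)
      0<qʲ = ^-pos j 0<1-ε

      J*-logq≤logx : (J * - log q) ≤ log x
      -- Adding j log q to both sides replaces the logarithm of an inverse by that of the product (q
      -- ^ j)⁻¹ * q ^ j = 1.
      J*-logq≤logx = +-cancelʳ-≤ (J * log q) (begin
        J * - log q + J * log q            ≈⟨ distribˡ J (- log q) (log q) ⟨
        J * (- log q + log q)              ≈⟨ *-congˡ (-‿inverseˡ (log q)) ⟩
        J * 0#                             ≈⟨ zeroʳ J ⟩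
        0#                                 ≈⟨ log1≈0 ⟨
        log 1#                             ≈⟨ log-cong
          (trans (*-comm _ _) (⁻¹-inverse (>⇒≉0 0<qʲ))) ⟨
        log ((q ^ j) ⁻¹ * q ^ j)           ≈⟨ log-* (⁻¹-pos 0<qʲ) 0<qʲ ⟩
        log ((q ^ j) ⁻¹) + log (q ^ j)     ≤⟨ +-monoˡ-≤ _ (log-mono-≤ (⁻¹-pos 0<qʲ) q⁻ʲ≤x) ⟩
        log x + log (q ^ j)                ≈⟨ +-congˡ (log-^ j 0<1-ε) ⟩
        log x + J * log q                  ∎)

      j*log2≤ : (J * log 2#) ≤ (2# * ε ⁻¹ * log x)
      j*log2≤ = begin
        J * log 2#                  ≤⟨ *-monoʳ-≤ (fromℕ-nonNeg j) log2≤ ⟩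
        J * (2# * ε ⁻¹ * - log q)   ≈⟨ solve 3 (λ j e l →
          (j :* (e :* l)) := (e :* (j :* l))) refl J (2# * ε ⁻¹) (- log q) ⟩
        2# * ε ⁻¹ * (J * - log q)   ≤⟨ *-monoʳ-≤
          (*-nonNeg (proj₁ 0<2) (proj₁ (⁻¹-pos 0<ε))) J*-logq≤logx ⟩
        2# * ε ⁻¹ * log x           ∎

-- The number of thresholds.

module ThresholdCount {c ℓ₁ ℓ₂ a ℓ} {R : RealField c ℓ₁ ℓ₂} (I : Input R a ℓ) where
  open RealField R
  open FieldProperties R
  open Input I
  open TotalOrder totalOrder using (poset)
    renaming (reflexive to ≤-reflexive; trans to ≤-trans)
  open PartialOrderReasoning poset
  open SemiringMult semiring using (×1-homo-*)
  open SemiringSolver commutativeSemiring using (solve; _:=_; _:+_; _:*_)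
  private module M = MetricSpace space
  open IsGeneralMetric M.isMetric using (nonNegative; 0⇒≈)

  0<dmin : 0# < dmin
  0<dmin with x , y , x≢y , dmin≈dxy ← dmin-attained =
    ≤-trans nonNegative (≤-reflexive (sym dmin≈dxy)) ,
    λ 0≈dmin → x≢y (distinct (0⇒≈ (trans (sym dmin≈dxy) (sym 0≈dmin))))

  threshold : ∀ i → (∃[ j ] (U ‼ i) ≈ (dmin * ((1# - ε) ^ j) ⁻¹)) × dmin ≤ (U ‼ i) × (U ‼ i) ≤ dmax
  threshold i = Equivalence.to (U-spec (U ‼ i)) (VecAny.map reflexive (∈-lookup i U))

  exponent : Fin n → ℕ
  exponent i = proj₁ (proj₁ (threshold i))

  -- Equal exponents give equal thresholds up to `≈`, and `U` has no repetitions. By the pigeonhole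
  -- principle, a bound on the exponents is then a bound on `n`.
  exponent-injective : ∀ {i j} → exponent i ≡ exponent j → i ≡ j
  exponent-injective {i} {j} eq = VecUnique.lookup-injective setoid U-unique i j (begin-equality
    U ‼ i                                  ≈⟨ proj₂ (proj₁ (threshold i)) ⟩
    dmin * ((1# - ε) ^ exponent i) ⁻¹      ≡⟨ ≡.cong (λ e → dmin * ((1# - ε) ^ e) ⁻¹) eq ⟩
    dmin * ((1# - ε) ^ exponent j) ⁻¹      ≈⟨ proj₂ (proj₁ (threshold j)) ⟨
    U ‼ j                                  ∎)

  module _ {Δ₀} (1<Δ₀ : 1# < Δ₀) (Δ₀≤Δ : Δ₀ ≤ Δ) where

    0<Δ : 0# < Δ
    0<Δ = <-≤-trans 0<1 (≤-trans (proj₁ 1<Δ₀) Δ₀≤Δ)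

    logΔ/ε : Carrier
    logΔ/ε = log Δ * ε ⁻¹

    0≤logΔ : 0# ≤ log Δ
    0≤logΔ = proj₁ (log-pos (<-≤-trans 1<Δ₀ Δ₀≤Δ))

    logΔ₀≤logΔ/ε : log Δ₀ ≤ logΔ/ε
    logΔ₀≤logΔ/ε = begin
      log Δ₀         ≤⟨ log-mono-≤ (<-≤-trans 0<1 (proj₁ 1<Δ₀)) Δ₀≤Δ ⟩
      log Δ          ≈⟨ *-identityʳ (log Δ) ⟨
      log Δ * 1#     ≤⟨ *-monoʳ-≤ 0≤logΔ (1≤x⁻¹ ε>0 (proj₁ ε<1)) ⟩
      log Δ * ε ⁻¹   ∎

    exponent≤ : ∀ i → fromℕ (exponent i) ≤ (2# * log 2# ⁻¹ * logΔ/ε)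
    exponent≤ i with (j , μ≈) , _ , μ≤dmax ← threshold i =
      exponent-bound ε>0 ε<1 j 0<Δ (*⇒≤-*⁻¹ 0<dmin (begin
        ((1# - ε) ^ j) ⁻¹ * dmin    ≈⟨ *-comm _ dmin ⟩
        dmin * ((1# - ε) ^ j) ⁻¹    ≈⟨ μ≈ ⟨
        U ‼ i                       ≤⟨ μ≤dmax ⟩
        dmax                        ∎))

    y : Carrier
    y = 2# * log 2# ⁻¹ * logΔ/ε

    0≤y : 0# ≤ y
    0≤y = *-nonNeg (*-nonNeg (proj₁ 0<2) (proj₁ (⁻¹-pos (log-pos 1<2))))
                   (*-nonNeg 0≤logΔ (proj₁ (⁻¹-pos ε>0)))

    -- At most ⌈y⌉ + 1 ≤ y + 2 distinct exponents lie below y, and 2 ≤ 2 log Δ / (ε log Δ₀).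
    threshold-count : fromℕ n ≤ (rate Δ₀ * logΔ/ε)
    threshold-count with ceiling 0≤y
    ... | m , y≤m , m≤1+y = begin
      fromℕ n                ≤⟨ fromℕ-mono-≤ n≤1+m ⟩
      1# + fromℕ m           ≤⟨ +-monoʳ-≤ 1# m≤1+y ⟩
      1# + (1# + y)          ≈⟨ +-assoc 1# 1# y ⟨
      2# + y                 ≤⟨ +-monoˡ-≤ y 2≤ ⟩
      2# * (log Δ₀ ⁻¹ * logΔ/ε) + y  ≈⟨ solve 4 (λ t a b l →
        (t :* (a :* l) :+ t :* b :* l) := (t :* (a :+ b) :* l))
        refl 2# (log Δ₀ ⁻¹) (log 2# ⁻¹) logΔ/ε ⟩
      rate Δ₀ * logΔ/ε       ∎
      where
      2≤ : 2# ≤ (2# * (log Δ₀ ⁻¹ * logΔ/ε))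
      2≤ = begin
        2#                            ≈⟨ *-identityʳ 2# ⟨
        2# * 1#                       ≤⟨ *-monoʳ-≤ (proj₁ 0<2) (*⇒≤-*⁻¹ (log-pos 1<Δ₀)
                                           (≤-trans (≤-reflexive (*-identityˡ _)) logΔ₀≤logΔ/ε)) ⟩
        2# * (logΔ/ε * log Δ₀ ⁻¹)     ≈⟨ *-congˡ (*-comm _ _) ⟩
        2# * (log Δ₀ ⁻¹ * logΔ/ε)     ∎

      exponent<1+m : ∀ i → exponent i <ₙ suc m
      exponent<1+m i = s≤s (fromℕ-cancel-≤ (≤-trans (exponent≤ i) y≤m))

      n≤1+m : n ≤ₙ suc m
      n≤1+m = Fin.injective⇒≤ {f = λ i → fromℕ< (exponent<1+m i)}
        (λ eq → exponent-injective (Fin.fromℕ<-injective _ _ (exponent<1+m _) (exponent<1+m _) eq))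

    -- Every cost has the shape c times a times `n`, with `a` equal to k or k²; replacing `n` by its
    -- bound leaves a constant that depends only on `c` and `Δ₀`.
    cost-bound : ∀ c {t} a → t ≤ₙ c *ₙ (a *ₙ n) →
                 fromℕ t ≤ (fromℕ c * rate Δ₀ * (fromℕ a * log Δ * ε ⁻¹))
    cost-bound c {t} a t≤can = begin
      fromℕ t                                ≤⟨ fromℕ-mono-≤ t≤can ⟩
      fromℕ (c *ₙ (a *ₙ n))                  ≈⟨ trans (×1-homo-* c (a *ₙ n))
                                                      (*-congˡ (×1-homo-* a n)) ⟩
      fromℕ c * (fromℕ a * fromℕ n)          ≤⟨ *-monoʳ-≤ (fromℕ-nonNeg c)
                                                  (*-monoʳ-≤ (fromℕ-nonNeg a) threshold-count) ⟩
      fromℕ c * (fromℕ a * (rate Δ₀ * logΔ/ε)) ≈⟨ solve 5 (λ c a r l e →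
        (c :* (a :* (r :* (l :* e)))) := (c :* r :* (a :* l :* e)))
        refl (fromℕ c) (fromℕ a) (rate Δ₀) (log Δ) (ε ⁻¹) ⟩
      fromℕ c * rate Δ₀ * (fromℕ a * log Δ * ε ⁻¹) ∎

sum-map-≤ : ∀ {a n} {A : Set a} (f : A → ℕ) {b} (xs : Vec A n) →
            (∀ i → f (xs ‼ i) ≤ₙ b) → Vec.sum (Vec.map f xs) ≤ₙ n *ₙ b
sum-map-≤ f []       f≤b = z≤n
sum-map-≤ f (x ∷ xs) f≤b = ℕ.+-mono-≤ (f≤b zero) (sum-map-≤ f xs (f≤b ∘ suc))

-- `P` takes the index because the capacity of a group candidate depends on its group.
lookup-update-∀ : ∀ {a p n} {A : Set a} (P : Fin n → A → Set p) (xs : Vec A n) y j →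
                  (∀ i → P i (xs ‼ i)) → P j y → ∀ i → P i ((xs [ j ]≔ y) ‼ i)
lookup-update-∀ P xs y j Pxs Py i with i Fin.≟ j
... | yes ≡.refl = ≡.subst (P j) (≡.sym (lookup∘update j xs y)) Py
... | no  i≢j    = ≡.subst (P i) (≡.sym (lookup∘update′ i≢j xs y)) (Pxs i)

-- Costs of the programs: length invariants of the memory.

module Cost
  {c ℓ₁ ℓ₂} (R : RealField c ℓ₁ ℓ₂)
  {N : ℕ} (group : Fin N → Group) (ks : Group → ℕ)
  {n : ℕ} (U : Vec (RealField.Carrier R) n)
  (d : Fin N → Fin N → RealField.Carrier R)
  where

  open Data.Nat using (_+_; _*_; _∸_; _⊔_; _≤_; _<_; _<?_)
  open ≡ using (refl; sym; trans; cong; subst)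
  open RealField R using (Carrier; _≤∞?_)
  open Algorithm R group ks U
  open +-*-Solver using (solve; _:=_; _:+_; _:*_; _:^_; con)

  ks≤k : ∀ i → ks i ≤ k
  ks≤k zero       = ℕ.m≤m+n _ _
  ks≤k (suc zero) = ℕ.m≤n+m _ _

  -- Only the bound on `all` is a parameter: it is `k` during the stream and `k + k` once S_μ may
  -- have been grown, whereas post-processing leaves the group candidates alone.
  record SlotBounded (b : ℕ) (s : Slot) : Set where
    constructor _,_
    field
      all≤ : length (all s) ≤ b
      own≤ : ∀ i → length (own s ‼ i) ≤ ks i

  open SlotBounded

  record Bounded (b : ℕ) (m : Memory) : Set where
    constructor bounded
    field
      slot-bounded : ∀ j → SlotBounded b (m ‼ j)

  open Bounded

  write-bounded : ∀ {b m s} j → Bounded b m → SlotBounded b s → Bounded b (m [ j ]≔ s)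
  write-bounded {m = m} {s} j (bounded bs) bs′ =
    bounded (lookup-update-∀ (λ _ → SlotBounded _) m s j bs bs′)

  -- Only the first loop of the post-processing enlarges a full S_μ, by at most
  -- k elements; S_{μ,1} and S_{μ,2} together have at most k more.
  capacity : ℕ
  capacity = n * (k + k + k)

  Fits : Memory → Set
  Fits = Bounded (k + k)

  Bounded-k⇒Fits : ∀ {m} → Bounded k m → Fits m
  Bounded-k⇒Fits (bounded bs) = bounded λ j → ℕ.≤-trans (all≤ (bs j)) (ℕ.m≤m+n k k) , own≤ (bs j)

  slotSize-≤ : ∀ {b} s → SlotBounded b s → slotSize s ≤ b + k
  slotSize-≤ (slot S (S₁ ∷ S₂ ∷ [])) (all≤ , own≤) = ℕ.+-mono-≤ all≤
    (ℕ.+-mono-≤ (own≤ zero) (ℕ.≤-trans (ℕ.≤-reflexive (ℕ.+-identityʳ _)) (own≤ (suc zero))))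

  size-≤ : ∀ {m} → Fits m → size m ≤ capacity
  size-≤ {m} (bounded bs) = sum-map-≤ slotSize m (λ j → slotSize-≤ (m ‼ j) (bs j))

  -- A program logic for time and memory.

  record Split {a b} {A : Set a} {B : Set b} (p : Prog A) (g : A → Prog B)
               (m : Memory) (z : B) (m″ : Memory) (t s : ℕ) : Set (a Level.⊔ b Level.⊔ c) where
    constructor split
    field
      {mid}         : A
      {m′}          : Memory
      {t₁ t₂ s₁ s₂} : ℕ
      first         : Run d p m mid m′ t₁ s₁
      second        : Run d (g mid) m′ z m″ t₂ s₂
      time          : t ≡ t₁ + t₂
      space         : s ≤ s₁ ⊔ s₂

  -- The induction is on the program, since `p >>= g` reduces only once the head of `p` is known.
  -- Time adds up exactly; for memory, the `return` that ends the first run records a size of its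
  -- own, so only an inequality is claimed.
  split->>= : ∀ {a b} {A : Set a} {B : Set b} (p : Prog A) {g : A → Prog B} {m z m″ t s} →
              Run d (p >>= g) m z m″ t s → Split p g m z m″ t s
  split->>= (return x)   r = split return r refl (ℕ.m≤n⊔m _ _)
  split->>= (dist x y f) (dist r) with split->>= (f (d x y)) r
  ... | split r₁ r₂ t≡ s≤ = split (dist r₁) r₂ (cong suc t≡) s≤
  split->>= (choose l f) (choose i r) with split->>= (f i) r
  ... | split r₁ r₂ t≡ s≤ = split (choose i r₁) r₂ t≡ s≤
  split->>= (get f) {m = m} (get r) with split->>= (f m) r
  ... | split r₁ r₂ t≡ s≤ = split (get r₁) r₂ t≡ s≤
  split->>= (put m₁ p) {m = m} (put r) with split->>= p r
  ... | split {s₁ = s₁} {s₂} r₁ r₂ t≡ s≤ = split (put r₁) r₂ t≡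
    (ℕ.≤-trans (ℕ.⊔-monoʳ-≤ (size m) s≤) (ℕ.≤-reflexive (sym (ℕ.⊔-assoc (size m) s₁ s₂))))

  -- A Hoare triple whose precondition is equality with the memory m.
  record Spec {a} {A : Set a} (p : Prog A) (m : Memory) (T : ℕ) (Q : A → Memory → Set)
         : Set (a Level.⊔ c) where
    constructor spec
    field
      sound : ∀ {x m′ t s} → Run d p m x m′ t s → t ≤ T × s ≤ capacity × Q x m′

  open Spec

  Pure : ∀ {a} {A : Set a} → Memory → ℕ → Prog A → Set (a Level.⊔ c)
  Pure m T p = Spec p m T (λ _ m′ → m′ ≡ m)

  module _ {a} {A : Set a} where

    spec-return : ∀ {x : A} {m T} {Q : A → Memory → Set} →
                  Fits m → Q x m → Spec (return x) m T Q
    spec-return fits q = spec λ { return → z≤n , size-≤ fits , q }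

    spec-dist : ∀ {x y} {f : Carrier → Prog A} {m T} {Q : A → Memory → Set} →
                Spec (f (d x y)) m T Q → Spec (dist x y f) m (suc T) Q
    spec-dist (spec h) = spec λ { (dist r) →
      let t≤ , s≤ , q = h r in s≤s t≤ , s≤ , q }

    -- For `l` equal to 0 there is no run and the triple holds vacuously, so `pick` asks for no
    -- proof of nonemptiness.
    spec-choose : ∀ {l} {f : Fin l → Prog A} {m T} {Q : A → Memory → Set} →
                  (∀ i → Spec (f i) m T Q) → Spec (choose l f) m T Q
    spec-choose h = spec λ { (choose i r) → sound (h i) r }

    spec-get : ∀ {f : Memory → Prog A} {m T} {Q : A → Memory → Set} →
               Spec (f m) m T Q → Spec (get f) m T Q
    spec-get (spec h) = spec λ { (get r) → h r }

    spec-put : ∀ {p : Prog A} {m m₁ T} {Q : A → Memory → Set} →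
               Fits m → Spec p m₁ T Q → Spec (put m₁ p) m T Q
    spec-put fits (spec h) = spec λ { (put r) →
      let t≤ , s≤ , q = h r in t≤ , ℕ.⊔-lub (size-≤ fits) s≤ , q }

    spec-⊆ : ∀ {p : Prog A} {m T} {Q Q′ : A → Memory → Set} →
             (∀ {x m′} → Q x m′ → Q′ x m′) → Spec p m T Q → Spec p m T Q′
    spec-⊆ Q⊆Q′ (spec h) = spec λ r → let t≤ , s≤ , q = h r in t≤ , s≤ , Q⊆Q′ q

    spec-≤ : ∀ {p : Prog A} {m T T′} {Q : A → Memory → Set} → T ≤ T′ →
             Spec p m T Q → Spec p m T′ Q
    spec-≤ T≤T′ (spec h) = spec λ r →
      let t≤ , s≤ , q = h r in ℕ.≤-trans t≤ T≤T′ , s≤ , q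

  module _ {a} {A : Set a} where

    module _ {b} {B : Set b} (p : Prog A) {g : A → Prog B} {m : Memory}
             {Q : A → Memory → Set} {Q′ : B → Memory → Set} where

      -- `T₂` is fixed before the intermediate result is known, so costs that depend on that result
      -- are first raised to a uniform bound by `spec-≤`.
      spec->>= : ∀ {T₁ T₂} → Spec p m T₁ Q →
                 (∀ {x m′} → Q x m′ → Spec (g x) m′ T₂ Q′) →
                 Spec (p >>= g) m (T₁ + T₂) Q′
      spec->>= {T₁} {T₂} (spec h₁) h₂ = spec λ r → combine (split->>= p r)
        where
        combine : ∀ {z m″ t s} → Split p g m z m″ t s →
                  t ≤ T₁ + T₂ × s ≤ capacity × Q′ z m″
        combine (split r₁ r₂ refl s≤) with h₁ r₁
        ... | t₁≤ , s₁≤ , q with sound (h₂ q) r₂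
        ... | t₂≤ , s₂≤ , q′ = ℕ.+-mono-≤ t₁≤ t₂≤ , ℕ.≤-trans s≤ (ℕ.⊔-lub s₁≤ s₂≤) , q′

      spec->>=-free : ∀ {T} → Spec p m T Q →
                      (∀ {x m′} → Q x m′ → Spec (g x) m′ 0 Q′) →
                      Spec (p >>= g) m T Q′
      spec->>=-free h₁ h₂ = spec-≤ (ℕ.≤-reflexive (ℕ.+-identityʳ _)) (spec->>= h₁ h₂)

    spec-pick : ∀ {m T} (xs : List A) → Fits m → Pure m T (pick xs)
    spec-pick xs fits = spec-choose λ _ → spec-return fits refl

  module _ {a} {A : Set a} where

    -- The invariant sees the elements still to be visited: the repair loop has to know that the
    -- slots ahead are still short.
    spec-forM : ∀ {f : A → Prog ⊤} {T} (I : List A → Memory → Set) →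
                (∀ {xs m} → I xs m → Fits m) →
                (∀ {x xs m} → I (x ∷ xs) m → Spec (f x) m T (λ _ → I xs)) →
                ∀ xs {m} → I xs m → Spec (forM_ xs f) m (length xs * T) (λ _ → I [])
    spec-forM I fits step []       inv = spec-return (fits inv) inv
    spec-forM I fits step (x ∷ xs) inv =
      spec->>= _ (step inv) (spec-forM I fits step xs)

    -- The length of the result is tracked because it bounds the pool of `grow`, and with it the
    -- cost of each round.
    spec-mapM : ∀ {b} {B : Set b} {f : A → Prog B} {m T} → Fits m →
                (∀ x → Pure m T (f x)) →
                ∀ xs → Spec (mapM f xs) m (length xs * T)
                         (λ ys m′ → length ys ≡ length xs × m′ ≡ m)
    spec-mapM fits h []       = spec-return fits (refl , refl)
    spec-mapM fits h (x ∷ xs) =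
      spec->>= _ (h x) λ { refl →
      spec->>=-free _ (spec-mapM fits h xs) λ { (eq , refl) →
      spec-return fits (cong suc eq , refl) } }

  module _ {m : Memory} (fits : Fits m) where

    spec-distTo : ∀ x S → Pure m (length S) (distTo x S)
    spec-distTo x []      = spec-return fits refl
    spec-distTo x (y ∷ S) = spec-dist
      (spec->>=-free _ (spec-distTo x S) λ { refl → spec-return fits refl })

    spec-diversity : ∀ S → Pure m (length S * length S) (diversity S)
    spec-diversity []      = spec-return fits refl
    -- The target `suc l * suc l` unfolds to `suc l + l * suc l`, which dominates `l + l * l`
    -- termwise.
    spec-diversity (x ∷ S) = spec-≤ (ℕ.+-mono-≤ (ℕ.n≤1+n l) (ℕ.*-monoʳ-≤ l (ℕ.n≤1+n l)))
      (spec->>= _ (spec-distTo x S) λ { refl →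
       spec->>=-free _ (spec-diversity S) λ { refl → spec-return fits refl } })
      where
      l : ℕ
      l = length S

    spec-withDistTo : ∀ S x → Pure m (length S) (withDistTo S x)
    spec-withDistTo S x =
      spec->>=-free _ (spec-distTo x S) λ { refl → spec-return fits refl }

    -- An element enters only after the test `length S <? cap` succeeds, which leaves room for it;
    -- the distances computed are those to the old `S`, hence at most `cap`.
    spec-tryAdd : ∀ cap μ x S → length S ≤ cap →
                  Spec (tryAdd cap μ x S) m cap (λ S′ m′ → length S′ ≤ cap × m′ ≡ m)
    spec-tryAdd cap μ x S S≤cap with length S <? cap
    ... | no  _     = spec-return fits (S≤cap , refl)
    ... | yes S<cap = spec-≤ S≤cap
      (spec->>=-free _ (spec-distTo x S) λ { {r} refl → spec-return fits (added r , refl) })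
      where
      added : ∀ r → length (if does ([ μ ] ≤∞? r) then x ∷ S else S) ≤ cap
      added r with does ([ μ ] ≤∞? r)
      ... | true  = S<cap
      ... | false = S≤cap

  -- Stream processing.

  Bounded-empty : Bounded k empty
  Bounded-empty = bounded λ j →
    subst (SlotBounded k) (sym (lookup-replicate j (slot [] (Vec.replicate 2 []))))
    (z≤n , λ { zero → z≤n ; (suc zero) → z≤n })

  spec-observe : ∀ x {m} → Bounded k m → Spec (observe x) m (n * (k + k)) (λ _ → Bounded k)
  spec-observe x bd = spec-≤ (ℕ.≤-reflexive (cong (_* (k + k)) (length-tabulate {n = n} _)))
    (spec-forM (λ _ → Bounded k) Bounded-k⇒Fits (λ {j} → step j) (allFin n) bd)
    where
    i : Group
    i = group x

    step : ∀ j {m} → Bounded k m → Spec _ m (k + k) (λ _ → Bounded k)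
    step j {m} bd = spec-get
      -- The group candidate costs `ks i`, rounded up to `k` to make the bound independent of the
      -- group of `x`.
      (spec-≤ (ℕ.+-monoʳ-≤ k (ks≤k i))
      (spec->>= (tryAdd k (U ‼ j) x (all (m ‼ j)))
                (spec-tryAdd fits k (U ‼ j) x _ (all≤ (slot-bounded bd j))) λ { (S≤k , refl) →
       spec->>=-free (tryAdd (ks i) (U ‼ j) x (own (m ‼ j) ‼ i))
                (spec-tryAdd fits (ks i) (U ‼ j) x _ (own≤ (slot-bounded bd j) i))
                λ { (Sᵢ≤kᵢ , refl) →
       spec-get (spec-put fits (spec-return (Bounded-k⇒Fits (bd′ S≤k Sᵢ≤kᵢ)) (bd′ S≤k Sᵢ≤kᵢ))) } }))
      where
      fits : Fits m
      fits = Bounded-k⇒Fits bd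

      bd′ : ∀ {S Sᵢ} → length S ≤ k → length Sᵢ ≤ ks i →
            Bounded k (m [ j ]≔ slot S (own (m ‼ j) [ i ]≔ Sᵢ))
      bd′ S≤k Sᵢ≤kᵢ = write-bounded j bd
        (S≤k , lookup-update-∀ (λ i S → length S ≤ ks i) (own (m ‼ j)) _ i
                 (own≤ (slot-bounded bd j)) Sᵢ≤kᵢ)

  spec-stream : ∀ xs {m} → Bounded k m →
                Spec (stream xs) m (length xs * (n * (k + k))) (λ _ → Bounded k)
  spec-stream = spec-forM (λ _ → Bounded k) Bounded-k⇒Fits (λ {x} → spec-observe x)

  -- Post-processing.

  -- The states in which the post-processing of S_μ, μ the j-th threshold,
  -- started from the memory m₀, can be.
  record Local (j : Fin n) (m₀ m : Memory) : Set where
    constructor local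
    field
      fits  : Fits m
      frame : ∀ i → i ≢ j → m ‼ i ≡ m₀ ‼ i

  open Local

  write-local : ∀ {j m₀ m s} → Local j m₀ m → SlotBounded (k + k) s → Local j m₀ (m [ j ]≔ s)
  write-local {j} {m₀} {m} {s} (local fits frame) bs = local (write-bounded j fits bs)
    (λ i i≢j → trans (lookup∘update′ i≢j m s) (frame i i≢j))

  module _ {j : Fin n} {m₀ : Memory} where

    spec-insert : ∀ x {m} → Local j m₀ m → length (all (m ‼ j)) < k + k →
                  Spec (insert j x) m 0 (λ _ m′ →
                    Local j m₀ m′ × length (all (m′ ‼ j)) ≡ suc (length (all (m ‼ j))))
    spec-insert x {m} loc room = spec-get (spec-get (spec-put (fits loc) (spec-return (fits loc′)
      (loc′ , cong (length ∘ all) (lookup∘update j m _)))))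
      where
      loc′ : Local j m₀ (m [ j ]≔ record (m ‼ j) { all = x ∷ all (m ‼ j) })
      loc′ = write-local loc (room , own≤ (slot-bounded (fits loc) j))

    spec-remove : ∀ x {m} → Local j m₀ m → Spec (remove j x) m 0 (λ _ → Local j m₀)
    spec-remove x {m} loc = spec-get (spec-get (spec-put (fits loc) (spec-return (fits loc′) loc′)))
      where
      loc′ : Local j m₀
        (m [ j ]≔ record (m ‼ j) { all = filter (λ y → ¬? (y Fin.≟ x)) (all (m ‼ j)) })
      loc′ with all≤ , own≤ ← slot-bounded (fits loc) j =
        write-local loc (ℕ.≤-trans (length-filter _ (all (m ‼ j))) all≤ , own≤)

    -- Current length plus remaining rounds stays constant, so S_μ never outgrows `k + k`, whatever
    -- ties are chosen. Each round spends one distance per pool element.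
    spec-grow : ∀ r {pool m} → Local j m₀ m → length (all (m ‼ j)) + r ≤ k + k → length pool ≤ k →
                Spec (grow j r pool) m (r * k) (λ _ → Local j m₀)
    spec-grow zero    loc room pool≤k = spec-return (fits loc) loc
    spec-grow (suc r) {pool} {m} loc room pool≤k =
      spec->>= (pick (argmax pool)) (spec-pick {T = 0} (argmax pool) (fits loc)) λ { {x⁺} refl →
      spec->>= (insert j x⁺) (spec-insert x⁺ loc
        (ℕ.≤-trans (ℕ.m≤m+n _ r) (ℕ.≤-trans (ℕ.≤-reflexive (sym (ℕ.+-suc _ r))) room)))
        λ { (loc′ , eq) →
      spec->>= _ (spec-≤ (ℕ.≤-trans (ℕ.≤-reflexive (ℕ.*-identityʳ _)) pool≤k)
        (spec-mapM (fits loc′) (λ (x , _) →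
          spec-dist {x = x} {x⁺} {T = 0} (spec-return (fits loc′) refl)) pool)) λ { (len , refl) →
      spec-grow r loc′
        (ℕ.≤-trans (ℕ.≤-reflexive (trans (cong (_+ r) eq) (sym (ℕ.+-suc _ r)))) room)
        (ℕ.≤-trans (ℕ.≤-reflexive len) pool≤k) } } }

    -- All distances were computed with the pool, so the loop itself is free. A removal is only
    -- known not to lengthen S_μ, which is why the diversity is later charged at length `k + k`.
    spec-shrink : ∀ r pool {m} → Local j m₀ m → Spec (shrink j r pool) m 0 (λ _ → Local j m₀)
    spec-shrink zero    pool loc = spec-return (fits loc) loc
    spec-shrink (suc r) pool loc =
      spec->>=-free (pick (argmin pool)) (spec-pick (argmin pool) (fits loc)) λ { {x⁻} refl →
      spec->>=-free (remove j x⁻) (spec-remove x⁻ loc)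
        (spec-shrink r (filter (λ (x , _) → ¬? (x Fin.≟ x⁻)) pool)) }

  -- The summands pay for the distances from S_{μ,i} to S_μ ∩ X_i, for at most k rounds of `grow`
  -- with at most k updates each, and for the pool of `shrink`, where both parts of the grown S_μ
  -- are bounded by 2k.
  balance-cost : ℕ
  balance-cost = k * k + (k * k + (k + k) * (k + k))

  spec-balance : ∀ j i {m} → Fits m → length (all (m ‼ j)) ≤ k →
                 Spec (balance j i) m balance-cost (λ _ → Local j m)
  spec-balance j i {m} fits all≤k = spec-get
    (spec->>= _ (spec-≤ (ℕ.*-mono-≤ own≤k (ℕ.≤-trans (length-filter _ S) all≤k))
      (spec-mapM fits (spec-withDistTo fits (S ∩ i)) (own (m ‼ j) ‼ i))) λ { (len , refl) →
     spec->>= _ (spec-≤ (ℕ.*-monoˡ-≤ k rounds≤k)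
      (spec-grow (ks i ∸ length (S ∩ i)) (local fits λ _ _ → refl) (ℕ.+-mono-≤ all≤k rounds≤k)
        (ℕ.≤-trans (ℕ.≤-reflexive len) own≤k))) λ { {_} {m′} loc →
     spec-get (spec->>=-free _ (spec-≤ (ℕ.*-mono-≤ (filter≤ _ loc) (filter≤ _ loc))
       (spec-mapM (Local.fits loc) (spec-withDistTo (Local.fits loc)
         (all (m′ ‼ j) ∩ i)) (all (m′ ‼ j) ∖ i)))
     λ { (_ , refl) →
     spec-shrink (length (all (m′ ‼ j)) ∸ k) _ loc }) } })
    where
    S : List Elem
    S = all (m ‼ j)

    own≤k : length (own (m ‼ j) ‼ i) ≤ k
    own≤k = ℕ.≤-trans (own≤ (slot-bounded fits j) i) (ks≤k i)

    rounds≤k : ks i ∸ length (S ∩ i) ≤ k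
    rounds≤k = ℕ.≤-trans (ℕ.m∸n≤m (ks i) (length (S ∩ i))) (ks≤k i)

    filter≤ : ∀ {p} {P : Elem → Set p} (P? : ∀ x → Dec (P x)) {m′} → Local j m m′ →
              length (filter P? (all (m′ ‼ j))) ≤ k + k
    filter≤ P? {m′} loc =
      ℕ.≤-trans (length-filter P? (all (m′ ‼ j))) (all≤ (slot-bounded (Local.fits loc) j))

  spec-repair : ∀ j {m} → Fits m → length (all (m ‼ j)) ≤ k →
                Spec (repair j) m balance-cost (λ _ → Local j m)
  spec-repair j {m} fits all≤k = spec-get (body _ refl)
    where
    -- Naming the continuation f exposes the case distinction to the with-abstraction.
    body : ∀ f → repair j ≡ get f → Spec (f m) m balance-cost (λ _ → Local j m)
    body f refl with Fin.any? (λ i → length (all (m ‼ j) ∩ i) <? ks i)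
    ... | yes (i , _) = spec-balance j i fits all≤k
    ... | no _        = spec-return fits (local fits λ _ _ → refl)

  -- A slot may be grown only once, from length at most `k`. Distinctness of the indices and the
  -- frame condition of `Local` preserve `small` for the slots ahead while one slot is repaired.
  record Pending (js : List (Fin n)) (m : Memory) : Set where
    constructor pending
    field
      fits   : Fits m
      unique : Unique js
      small  : All (λ j → length (all (m ‼ j)) ≤ k) js

  spec-repairs : ∀ js {m} → Pending js m →
                 Spec (forM_ js repair) m (length js * balance-cost) (λ _ → Pending [])
  spec-repairs = spec-forM Pending Pending.fits λ
    { {j} {js} {m} (pending fits (j∉js ∷ unique) (all≤k ∷ small)) →
      spec-⊆ (λ (local fits′ frame) → pending fits′ unique
          (All.zipWith (λ (j≢i , i≤k) →
             subst (λ s → length (all s) ≤ k) (sym (frame _ (j≢i ∘ sym))) i≤k) (j∉js , small)))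
        (spec-repair j fits all≤k) }

  spec-postprocess : ∀ {m} → Bounded k m →
                     Spec postprocess m (n * balance-cost + n * ((k + k) * (k + k))) (λ _ _ → ⊤)
  spec-postprocess {m} bd = spec-get
    (spec->>= _ (spec-≤ (ℕ.*-monoˡ-≤ balance-cost U′≤n) (spec-repairs U′ all-pending)) λ { p →
     spec->>=-free _ (spec-≤ (ℕ.*-monoˡ-≤ _ U′≤n)
       (spec-mapM (Pending.fits p) (diversity≤ (Pending.fits p)) U′)) λ { (_ , refl) →
     spec-choose λ _ → spec-return (Pending.fits p) tt } })
    where
    U′ : List (Fin n)
    U′ = filter (λ j → full? (m ‼ j)) (allFin n)

    all-pending : Pending U′ m
    -- `U′` is fixed before any repair and, as a filtered `allFin n`, has no repetitions; the stream
    -- invariant makes all its slots short.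
    all-pending = pending (Bounded-k⇒Fits bd) (Unique.filter⁺ _ (Unique.allFin⁺ n))
      (All.universal (λ j → all≤ (slot-bounded bd j)) U′)

    U′≤n : length U′ ≤ n
    U′≤n = ℕ.≤-trans (length-filter _ (allFin n)) (ℕ.≤-reflexive (length-tabulate {n = n} _))

    diversity≤ : ∀ {m′} → Fits m′ → ∀ j → Pure m′ ((k + k) * (k + k))
      (read j >>= λ s → diversity (all s) >>= λ v → return (all s , v))
    diversity≤ {m′} fits j = spec-get (spec->>=-free _
      (spec-≤ (ℕ.*-mono-≤ S≤ S≤) (spec-diversity fits (all (m′ ‼ j)))) λ { refl →
      spec-return fits refl })
      where
      S≤ : length (all (m′ ‼ j)) ≤ k + k
      S≤ = all≤ (slot-bounded fits j)

  -- Bounds for runs of the algorithm.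

  spec-sfdm1 : Spec sfdm1 empty _ (λ _ _ → ⊤)
  -- Only the memory bound is read off this composite, so its time is left to inference; each phase
  -- gets a time bound of its own.
  spec-sfdm1 = spec->>= _ (spec-stream (allFin N) Bounded-empty) spec-postprocess

  stored-at-once : ∀ {S m t s} → Run d sfdm1 empty S m t s → s ≤ capacity
  stored-at-once run = proj₁ (proj₂ (sound spec-sfdm1 run))

  -- The time bounds assume short candidates. The memories met by an arriving element or by
  -- post-processing are those left by a prefix of the stream, and there the assumption holds.
  stream-bounded : ∀ xs {r m t s} → Run d (stream xs) empty r m t s → Bounded k m
  stream-bounded xs run = proj₂ (proj₂ (sound (spec-stream xs Bounded-empty) run))

  observe-time : ∀ x {m r m′ t s} → Bounded k m → Run d (observe x) m r m′ t s →
                 t ≤ n * (k + k)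
  observe-time x bd run = proj₁ (sound (spec-observe x bd) run)

  postprocess-time : ∀ {m S m′ t s} → Bounded k m → Run d postprocess m S m′ t s →
                     t ≤ n * balance-cost + n * ((k + k) * (k + k))
  postprocess-time bd run = proj₁ (sound (spec-postprocess bd) run)

  capacity≡ : capacity ≡ 3 * (k * n)
  capacity≡ = solve 2 (λ n k → n :* (k :+ k :+ k) := con 3 :* (k :* n)) refl n k

  observe-cost≡ : n * (k + k) ≡ 2 * (k * n)
  observe-cost≡ = solve 2 (λ n k → n :* (k :+ k) := con 2 :* (k :* n)) refl n k

  postprocess-cost≡ : n * balance-cost + n * ((k + k) * (k + k)) ≡ 10 * (k ^ₙ 2 * n)
  postprocess-cost≡ = solve 2 (λ n k →
    n :* (k :* k :+ (k :* k :+ (k :+ k) :* (k :+ k))) :+ n :* ((k :+ k) :* (k :+ k))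
      := con 10 :* (k :^ 2 :* n)) refl n k

theorem3 : ∀ {c ℓ₁ ℓ₂ a ℓ} (R : RealField c ℓ₁ ℓ₂) → let open RealField R in
    ∀ Δ₀ → 1# < Δ₀ →
    ∃[ C ] ∀ (I : Input R a ℓ) → let open Input I in
    Δ₀ ≤ Δ →
    (∀ {S m t s} → Run d sfdm1 empty S m t s →
    fromℕ s ≤ (C * (fromℕ k * log Δ * ε ⁻¹)))
    ×
    (∀ xs x ys → allFin N ≡ xs ++ x ∷ ys →
    ∀ {r m t s r′ m′ t′ s′} →
    Run d (stream xs) empty r m t s → Run d (observe x) m r′ m′ t′ s′ →
    fromℕ t′ ≤ (C * (fromℕ k * log Δ * ε ⁻¹)))
    ×
    (∀ {r m t s S m′ t′ s′} →
    Run d (stream (allFin N)) empty r m t s → Run d postprocess m S m′ t′ s′ →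
    fromℕ t′ ≤ (C * (fromℕ (k ^ₙ 2) * log Δ * ε ⁻¹)))
-- 10 is the largest of the coefficients 3, 2 and 10 of the three bounds; the first two are raised
-- to it as 3 + 7 and 2 + 8.
theorem3 R Δ₀ 1<Δ₀ = fromℕ 10 * rate Δ₀ , λ I Δ₀≤Δ →
  let open Input I
      open Cost R group ks U d
      open ThresholdCount I using (cost-bound)
  in
  (λ run → cost-bound 1<Δ₀ Δ₀≤Δ 10 k
     (ℕ.≤-trans (stored-at-once run)
     (ℕ.≤-trans (ℕ.≤-reflexive capacity≡) (ℕ.*-monoˡ-≤ (k *ₙ n) (ℕ.m≤m+n 3 7))))) ,
  (λ xs x _ _ run run′ → cost-bound 1<Δ₀ Δ₀≤Δ 10 k
     (ℕ.≤-trans (observe-time x (stream-bounded xs run) run′)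
     (ℕ.≤-trans (ℕ.≤-reflexive observe-cost≡) (ℕ.*-monoˡ-≤ (k *ₙ n) (ℕ.m≤m+n 2 8))))) ,
  (λ run run′ → cost-bound 1<Δ₀ Δ₀≤Δ 10 (k ^ₙ 2)
     (ℕ.≤-trans (postprocess-time (stream-bounded (allFin N) run) run′)
     (ℕ.≤-reflexive postprocess-cost≡)))
  where
  open RealField R using (fromℕ; _*_)
  open FieldProperties R using (rate)
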